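{- A closure system $(X,\varphi)$ is an algebraic convex geometry with finite dimension if and only if $Cl(X,\varphi)=C(M)$ for some multichain $M$ on $X$.
   Context: A convex geometry is a closure operator $\varphi$ on a non-empty set $X$ with $\varphi(\emptyset)=\emptyset$ such that for every closed $A$ and $x\neq y$, $x\in\varphi(A\cup\{y\})$ and $x\notin A$ imply $y\notin\varphi(A\cup\{x\})$; it is algebraic if its lattice $Cl(X,\varphi)$ of closed sets is an algebraic lattice. Dimension here is the complete join-dimension of $Cl(X,\varphi)$: the least cardinal $\kappa$ such that $Cl(X,\varphi)$ admits a one-to-one map preserving arbitrary joins into a product of $\kappa$ complete chains. A multichain is $M=(X,(\leq_k)_{k=1,\dots,n})$ with $n$ finite and each $\leq_k$ a linear order on $X$; $C(M)$ is the family of all sets $\bigcap_{k=1}^n I_k$ where each $I_k$ is an initial segment of $(X,\leq_k)$.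
   Formalization: "Algebraic" here also requires the closure operator to be finitary (each point of φ(A) lies in φ(F) for a finite F ⊆ A), not only that Cl(X,φ) is an algebraic lattice; otherwise ℕ∪{∞} with closed sets {0,…,n−1} and the whole set is a counterexample. -}

module Defs where

open import Data.Fin.Base using (Fin)
open import Data.List.Base using (List)
open import Data.List.Membership.Propositional using () renaming (_∈_ to _∈ₗ_)
open import Data.List.Relation.Unary.All using (All)
open import Data.Nat.Base using (ℕ; NonZero)
open import Data.Product.Base using (∃; ∃-syntax; Σ-syntax; _×_; _,_; proj₁)
open import Data.Sum.Base using (_⊎_)
open import Function.Bundles using (Injection; _↣_)
open import Function.Base using (_∘_)
open import Level using (Level; _⊔_; suc)
open import Relation.Binary.Bundles using (Poset; TotalOrder)
open import Relation.Binary.Core using (Rel)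
import Relation.Binary.Construct.On as On
open import Relation.Binary.Indexed.Homogeneous using (IndexedPoset)
open import Relation.Binary.PropositionalEquality.Core using (_≡_; _≢_)
open import Relation.Binary.Structures using (IsTotalOrder)
open import Relation.Unary using (Pred; _∈_; _∉_; _⊆_; _≐_; _∪_; ｛_｝; ⋂)
open import Relation.Unary.Polymorphic using (∅)
open import Relation.Unary.Relation.Binary.Subset using (⊆-poset)

private
  variable
    c ℓ₁ ℓ₂ i k ℓ : Level

-- Zorn's lemma, as the form of the axiom of choice that can be assumed
-- next to excluded middle.  The bound for the empty chain makes P inhabited.

ZornsLemma : ∀ c ℓ₁ ℓ₂ p → Set (suc (c ⊔ ℓ₁ ⊔ ℓ₂ ⊔ p))
ZornsLemma c ℓ₁ ℓ₂ p =
  (P : Poset c ℓ₁ ℓ₂) → let open Poset P in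
  ((C : Pred Carrier p) →
    (∀ x y → x ∈ C → y ∈ C → x ≤ y ⊎ y ≤ x) →
    ∃[ u ] (∀ x → x ∈ C → x ≤ u)) →
  ∃[ m ] (∀ x → m ≤ x → x ≤ m)

------------------------------------------------------------------------
-- Complete lattices

-- Subsets of a poset are given as families.  Indices range over the
-- universe of the carrier, so classically every subset is such a family.

module _ (P : Poset c ℓ₁ ℓ₂) where
  open Poset P

  IsLub : {I : Set i} → (I → Carrier) → Carrier → Set (i ⊔ c ⊔ ℓ₂)
  IsLub a s = (∀ j → a j ≤ s) × (∀ y → (∀ j → a j ≤ y) → s ≤ y)

  IsGlb : {I : Set i} → (I → Carrier) → Carrier → Set (i ⊔ c ⊔ ℓ₂)
  IsGlb a s = (∀ j → s ≤ a j) × (∀ y → (∀ j → y ≤ a j) → y ≤ s)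

  IsCompleteLattice : Set (suc c ⊔ ℓ₂)
  IsCompleteLattice =
    (I : Set c) (a : I → Carrier) → ∃ (IsLub a) × ∃ (IsGlb a)

  IsCompact : Carrier → Set (suc c ⊔ ℓ₂)
  IsCompact x =
    (I : Set c) (a : I → Carrier) (s : Carrier) → IsLub a s → x ≤ s →
    ∃[ n ] ∃[ f ] ∃[ t ] (IsLub {I = Fin n} (a ∘ f) t × x ≤ t)

  record IsAlgebraicLattice : Set (suc c ⊔ ℓ₂) where
    field
      isCompleteLattice : IsCompleteLattice
      compactlyGenerated :
        ∀ x → Σ[ I ∈ Set c ] Σ[ a ∈ (I → Carrier) ] ((∀ j → IsCompact (a j)) × IsLub a x)

------------------------------------------------------------------------
-- Complete join-dimension

∏ : {K : Set k} → (K → TotalOrder c ℓ₁ ℓ₂) → Poset (k ⊔ c) (k ⊔ ℓ₁) (k ⊔ ℓ₂)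
∏ {c = c} {ℓ₁ = ℓ₁} {ℓ₂ = ℓ₂} {K = K} T = IndexedPoset.poset product
  where
  module T (j : K) = TotalOrder (T j)
  product : IndexedPoset K c ℓ₁ ℓ₂
  product = record
    { Carrierᵢ        = T.Carrier
    ; _≈ᵢ_            = λ {j} → T._≈_ j
    ; _≤ᵢ_            = λ {j} → T._≤_ j
    ; isPartialOrderᵢ = record
      { isPreorderᵢ = record
        { isEquivalenceᵢ = record
          { reflᵢ  = λ {j} → T.Eq.refl j
          ; symᵢ   = λ {j} → T.Eq.sym j
          ; transᵢ = λ {j} → T.Eq.trans j
          }
        ; reflexiveᵢ = λ {j} → T.reflexive j
        ; transᵢ     = λ {j} → T.trans j
        }
      ; antisymᵢ = λ {j} → T.antisym j
      }
    }

module _ (L : Poset c ℓ₁ ℓ₂) where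

  EmbedsInChains : Set k → Set (k ⊔ suc (c ⊔ ℓ₁ ⊔ ℓ₂))
  EmbedsInChains K =
    ∃[ T ] ((∀ j → IsCompleteLattice (TotalOrder.poset (T j)))
      × ∃[ f ] PreservesJoins T f)
    where
    PreservesJoins : (T : K → TotalOrder c ℓ₁ ℓ₂) →
      Injection (Poset.Eq.setoid L) (Poset.Eq.setoid (∏ T)) → Set _
    PreservesJoins T f =
      (I : Set c) (a : I → Poset.Carrier L) (s : Poset.Carrier L) →
      IsLub L a s → IsLub (∏ T) (Injection.to f ∘ a) (Injection.to f s)

  -- Cardinals are represented by types and compared by injections.

  IsDimension : Set k → Set (k ⊔ suc (c ⊔ ℓ₁ ⊔ ℓ₂))
  IsDimension K =
    EmbedsInChains K × ((K′ : Set c) → EmbedsInChains K′ → K ↣ K′)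

  HasFiniteDimension : Set (suc (c ⊔ ℓ₁ ⊔ ℓ₂))
  HasFiniteDimension = ∃[ n ] IsDimension (Fin n)

------------------------------------------------------------------------
-- Closure systems

-- Subsets of X are predicates at the level of X, compared by ≐.

record ClosureOperator (X : Set ℓ) : Set (suc ℓ) where
  field
    cl         : Pred X ℓ → Pred X ℓ
    extensive  : ∀ A → A ⊆ cl A
    monotone   : ∀ A B → A ⊆ B → cl A ⊆ cl B
    idempotent : ∀ A → cl (cl A) ≐ cl A

  Closed : Pred (Pred X ℓ) ℓ
  Closed A = cl A ≐ A

  Cl : Poset (suc ℓ) ℓ ℓ
  Cl = On.poset (⊆-poset X ℓ) (proj₁ {B = Closed})

module _ {X : Set ℓ} (φ : ClosureOperator X) where
  open ClosureOperator φ

  record IsConvexGeometry : Set (suc ℓ) where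
    field
      nonEmpty     : X
      cl-∅         : cl ∅ ≐ ∅ {ℓ = ℓ}
      antiExchange : ∀ A → Closed A → ∀ x y → x ≢ y →
                     x ∈ cl (A ∪ ｛ y ｝) → x ∉ A → y ∉ cl (A ∪ ｛ x ｝)

  -- Cl is algebraic as a lattice of subsets of X: besides being an algebraic
  -- lattice, closures are determined by those of finite sets.  The abstract
  -- lattice alone does not suffice: on ℕ ∪ {∞}, take as closed sets all
  -- {0,…,n-1} and the whole set.  These form a convex geometry and an
  -- algebraic lattice (the complete chain ω+1), but ℕ is a directed union of
  -- closed sets that is not closed, which no multichain allows.

  record IsAlgebraic : Set (suc (suc ℓ)) where
    field
      isAlgebraicLattice : IsAlgebraicLattice Cl
      finitary           : ∀ A x → x ∈ cl A →
                           ∃[ F ] (All (_∈ A) F × x ∈ cl (_∈ₗ F))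

------------------------------------------------------------------------
-- Multichains

-- The orders are indexed by 1,…,n, so n ≥ 1.

record Multichain (X : Set ℓ) : Set (suc ℓ) where
  field
    n            : ℕ
    n-nonZero    : NonZero n
    _≤[_]_       : X → Fin n → X → Set ℓ
    isTotalOrder : ∀ j → IsTotalOrder _≡_ (λ x y → x ≤[ j ] y)

IsInitialSegment : {X : Set ℓ} → Rel X ℓ → Pred (Pred X ℓ) ℓ
IsInitialSegment _≤_ A = ∀ x y → x ≤ y → y ∈ A → x ∈ A

C : {X : Set ℓ} → Multichain X → Pred (Pred X ℓ) (suc ℓ)
C M A =
  ∃[ I ] ((∀ j → IsInitialSegment (λ x y → x ≤[ j ] y) (I j)) × A ≐ ⋂ (Fin n) I)
  where open Multichain M

{-# OPTIONS --safe #-}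

-- (⇐) In a multichain, x lies in the closure of A exactly when, for every k,
-- x ≤ₖ a for some a ∈ A; sending A to its down-closures embeds Cl into n chains
-- of initial segments.
--
-- (⇒) Given a join-embedding f into chains T₁,…,Tₙ, comparing fₖ(cl ｛ x ｝)
-- yields total preorders on X whose principal down-sets are closed.  By Zorn's
-- lemma each has a minimal refinement with this property, and anti-exchange
-- makes it antisymmetric.  Finitarity makes its initial segments closed, and
-- injectivity of f makes every closed set an intersection of such segments.

module Submission where

open import Defs
open import Axiom.ExcludedMiddle using (ExcludedMiddle)
open import Axiom.DoubleNegationElimination using (em⇒dne)
open import Data.Bool.Base using (Bool; true; false)
open import Data.Empty using (⊥-elim)
open import Data.Fin.Base using (Fin; zero; suc)
open import Data.List.Base using ([]; _∷_; length; lookup; tabulate)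
open import Data.List.Membership.Propositional using () renaming (_∈_ to _∈ₗ_)
open import Data.List.Membership.Propositional.Properties using (∈-tabulate⁺; ∈-lookup)
open import Data.List.Relation.Unary.All as All using (All; []; _∷_)
open import Data.List.Relation.Unary.All.Properties using (tabulate⁺)
open import Data.List.Relation.Unary.Any using (index)
open import Data.List.Relation.Unary.Any.Properties using (lookup-index)
open import Data.Nat.Base using (ℕ; zero; suc; _<_; NonZero; nonZero)
open import Data.Nat.Induction using (<-rec)
open import Data.Nat.Properties using (m<n⇒m<1+n; n<1+n)
open import Data.Product.Base using (∃; ∃-syntax; Σ-syntax; _×_; _,_; proj₁; proj₂; swap)
open import Data.Sum.Base using (_⊎_; inj₁; inj₂; [_,_]′)
open import Function.Base using (_∘_; id)
open import Function.Bundles using (Injection; _↣_; mk↣; _⇔_; mk⇔)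
open import Level using (Lift; lift; lower) renaming (suc to lsuc)
open import Relation.Binary.Bundles using (Poset; TotalOrder)
open import Relation.Binary.Core using (Rel)
import Relation.Binary.Construct.On as On
open import Relation.Binary.Definitions using (Transitive; Total)
open import Relation.Binary.PropositionalEquality.Core
  using (_≡_; _≢_; refl; sym; subst; ≢-sym)
open import Relation.Binary.PropositionalEquality.Properties using (isEquivalence)
open import Relation.Binary.Structures using (IsTotalOrder)
open import Relation.Nullary.Decidable
  using (Dec; yes; no; True; toWitness; fromWitness)
open import Relation.Nullary.Negation using (¬_; contradiction)
open import Relation.Unary using (Pred; _∈_; _∉_; _⊆_; _≐_; _∪_; ｛_｝; ⋂)
open import Relation.Unary.Polymorphic using (∅)
open import Relation.Unary.Relation.Binary.Subset using (⊆-poset)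

-- Closures and principal closed sets.

module ClosureProperties {ℓ} {X : Set ℓ} (φ : ClosureOperator X) where
  open ClosureOperator φ

  ⊆⇒closed : ∀ {A} → cl A ⊆ A → Closed A
  ⊆⇒closed {A} clA⊆A = clA⊆A , extensive A

  cl-closed : ∀ A → Closed (cl A)
  cl-closed = idempotent

  cl-least : ∀ {A B} → Closed B → A ⊆ B → cl A ⊆ B
  cl-least {A} {B} B-closed A⊆B = proj₁ B-closed ∘ monotone A B A⊆B

  Cl₁ : X → Poset.Carrier Cl
  Cl₁ x = cl ｛ x ｝ , cl-closed ｛ x ｝

  x∈Cl₁ : ∀ x → x ∈ proj₁ (Cl₁ x)
  x∈Cl₁ x = extensive ｛ x ｝ refl

  Cl₁-least : ∀ {A x} → Closed A → x ∈ A → cl ｛ x ｝ ⊆ A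
  Cl₁-least A-closed x∈A = cl-least A-closed λ { refl → x∈A }

-- Consequences of excluded middle.

module Classical (em : ∀ {a} → ExcludedMiddle a) where

  byContradiction : ∀ {p} {P : Set p} → ¬ ¬ P → P
  byContradiction = em⇒dne em

  ¬∀⇒∃¬ : ∀ {a p} {A : Set a} {P : A → Set p} →
          ¬ (∀ x → P x) → ∃[ x ] ¬ P x
  ¬∀⇒∃¬ ¬∀ = byContradiction λ ¬∃ →
    ¬∀ λ x → byContradiction λ ¬Px → ¬∃ (x , ¬Px)

  -- Excluded middle makes Set impredicative for propositions.

  record Resize {p} ℓ (P : Set p) : Set ℓ where
    constructor resized
    field isTrue : True (em {P = P})

  resize : ∀ {p ℓ} {P : Set p} → P → Resize ℓ P
  resize p = resized (fromWitness p)

  unresize : ∀ {p ℓ} {P : Set p} → Resize ℓ P → P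
  unresize r = toWitness (Resize.isTrue r)

  least : ∀ {p} (P : ℕ → Set p) n → P n → ∃[ m ] (P m × ∀ k → k < m → ¬ P k)
  least P = <-rec (λ n → P n → ∃[ m ] (P m × ∀ k → k < m → ¬ P k)) step
    where
    step : ∀ n → (∀ {k} → k < n → P k → _) → P n → _
    step n rec Pn with em {P = ∃[ k ] (k < n × P k)}
    ... | yes (k , k<n , Pk) = rec k<n Pk
    ... | no ∄k              = n , Pn , λ k k<n Pk → ∄k (k , k<n , Pk)

  -- By induction on `m`: an injection that misses some `k` extends by sending `zero` to `k`; one
  -- that misses nothing already enumerates `K`.
  Fin↣⊎smaller : ∀ {k} (K : Set k) m →
    (Fin m ↣ K) ⊎
    ∃[ m′ ] (m′ < m × Σ[ e ∈ (Fin m′ → K) ] (∀ k → ∃[ i ] e i ≡ k))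
  Fin↣⊎smaller K zero = inj₁ (mk↣ {to = λ ()} λ { {()} })
  Fin↣⊎smaller K (suc m) with Fin↣⊎smaller K m
  ... | inj₂ (m′ , m′<m , surj) = inj₂ (m′ , m<n⇒m<1+n m′<m , surj)
  ... | inj₁ g with em {P = ∀ k → ∃[ i ] Injection.to g i ≡ k}
  ...   | yes surj = inj₂ (m , n<1+n m , Injection.to g , surj)
  ...   | no ¬surj with ¬∀⇒∃¬ ¬surj
  ...     | k , k∉im = inj₁ (mk↣ h-injective)
    where
    h : Fin (suc m) → K
    h zero    = k
    h (suc i) = Injection.to g i
    h-injective : ∀ {i j} → h i ≡ h j → i ≡ j
    h-injective {zero}  {zero}  _  = refl
    h-injective {zero}  {suc j} eq = contradiction (j , sym eq) k∉im
    h-injective {suc i} {zero}  eq = contradiction (i , eq) k∉im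
    h-injective {suc i} {suc j} eq with Injection.injective g eq
    ... | refl = refl

  -- Join-embeddings into products of chains, and dimension.

  module _ {k c ℓ₁ ℓ₂} {K : Set k} (T : K → TotalOrder c ℓ₁ ℓ₂) where

    -- Replacing the `k`-th coordinate of `s` by a bound `z` of the `k`-th coordinates gives an
    -- upper bound in the product, so minimality of `s` compares `s k` with `z`.
    ∏-lub-pointwise : ∀ {i} {I : Set i} {a : I → Poset.Carrier (∏ T)} {s} →
      IsLub (∏ T) a s →
      ∀ k → IsLub (TotalOrder.poset (T k)) (λ j → a j k) (s k)
    ∏-lub-pointwise {a = a} {s} (upper , minimal) k = (λ j → upper j k) , minimalₖ
      where
      module T (k : K) = TotalOrder (T k)
      minimalₖ : ∀ z → (∀ j → T._≤_ k (a j k) z) → T._≤_ k (s k) z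
      minimalₖ z bound =
        -- `update k em` does not reduce, because `em` is a hypothesis; `at-k` inspects its decision
        -- of `k ≡ k`.
        at-k em (minimal (λ k′ → update k′ em) (λ j k′ → bound′ j k′ em) k)
        where
        update : ∀ k′ → Dec (k ≡ k′) → T.Carrier k′
        update k′ (yes refl) = z
        update k′ (no _)     = s k′
        bound′ : ∀ j k′ d → T._≤_ k′ (a j k′) (update k′ d)
        bound′ j k′ (yes refl) = bound j
        bound′ j k′ (no _)     = upper j k′
        at-k : ∀ d → T._≤_ k (s k) (update k d) → T._≤_ k (s k) z
        at-k (yes refl) s≤z = s≤z
        at-k (no k≢k)   _   = contradiction refl k≢k

  -- Reindexing along a surjection may repeat chains but loses none, so injectivity survives; joins
  -- survive because they are computed coordinatewise.
  embedsInChains-surj : ∀ {c ℓ₁ ℓ₂ k k′} {L : Poset c ℓ₁ ℓ₂} {K : Set k} {K′ : Set k′}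
    (e : K′ → K) → (∀ k → ∃[ i ] e i ≡ k) →
    EmbedsInChains L K → EmbedsInChains L K′
  embedsInChains-surj e surj (T , complete , f , preserves) =
    T ∘ e , complete ∘ e ,
    record
      { to        = λ A i → to A (e i)
      ; cong      = λ A≈B i → cong A≈B (e i)
      ; injective = λ {A} {B} fA≈fB → injective λ k →
          let i , eᵢ≡k = surj k
          in subst (λ k → TotalOrder._≈_ (T k) (to A k) (to B k)) eᵢ≡k (fA≈fB i)
      } ,
    λ I a s lub →
      (λ j i → proj₁ (preserves I a s lub) j (e i)) ,
      (λ y bound i → proj₂ (∏-lub-pointwise T (preserves I a s lub) (e i)) (y i) λ j → bound j i)
    where open Injection f

  -- The dimension is the least `m` whose `Fin m` admits an embedding. If `Fin m` did not inject
  -- into `K`, a smaller `Fin m′` would enumerate `K` and inherit its embedding.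
  embedsInFin⇒finiteDimension : ∀ {c ℓ₁ ℓ₂} {L : Poset c ℓ₁ ℓ₂} n →
    EmbedsInChains L (Fin n) → HasFiniteDimension L
  embedsInFin⇒finiteDimension {c} {L = L} n embeds
    with least (λ m → EmbedsInChains L (Fin m)) n embeds
  ... | m , m-embeds , m-least = m , m-embeds , minimal
    where
    minimal : (K : Set c) → EmbedsInChains L K → Fin m ↣ K
    minimal K K-embeds with Fin↣⊎smaller K m
    ... | inj₁ g                     = g
    ... | inj₂ (m′ , m′<m , e , surj) =
      contradiction (embedsInChains-surj {L = L} e surj K-embeds) (m-least m′ m′<m)

  -- The lattice of closed sets.

  module Lattice {ℓ} {X : Set ℓ} (φ : ClosureOperator X) where
    open ClosureOperator φ
    open ClosureProperties φ

    module _ {i} {I : Set i} (a : I → Poset.Carrier Cl) where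

      union : Pred X ℓ
      union x = Resize ℓ (∃[ j ] x ∈ proj₁ (a j))

      join : Poset.Carrier Cl
      join = cl union , cl-closed union

      join-isLub : IsLub Cl a join
      join-isLub =
        (λ j x∈aⱼ → extensive union (resize (j , x∈aⱼ))) ,
        (λ B bound → cl-least {union} (proj₂ B) λ x∈⋃ →
          let j , x∈aⱼ = unresize x∈⋃ in bound j x∈aⱼ)

      meet : Poset.Carrier Cl
      meet = (λ x → Resize ℓ (∀ j → x ∈ proj₁ (a j))) ,
        ⊆⇒closed λ x∈cl → resize λ j →
          cl-least (proj₂ (a j)) (λ z∈⋂ → unresize z∈⋂ j) x∈cl

      meet-isGlb : IsGlb Cl a meet
      meet-isGlb = (λ j x∈⋂ → unresize x∈⋂ j) ,
        (λ B bound x∈B → resize λ j → bound j x∈B)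

    isCompleteLattice : IsCompleteLattice Cl
    isCompleteLattice I a = (join a , join-isLub a) , (meet a , meet-isGlb a)

    -- The lift puts the index type in the universe over which the families of `IsCompact` and of
    -- join preservation range.
    principals : (A : Pred X ℓ) → Lift (lsuc ℓ) (∃ A) → Poset.Carrier Cl
    principals A (lift (x , _)) = Cl₁ x

    principals-isLub : ∀ A → IsLub Cl (principals A) (cl A , cl-closed A)
    principals-isLub A =
      (λ { (lift (x , x∈A)) → Cl₁-least (cl-closed A) (extensive A x∈A) }) ,
      (λ B bound → cl-least (proj₂ B) λ {x} x∈A → bound (lift (x , x∈A)) (x∈Cl₁ x))

    module _ (finitary : ∀ A x → x ∈ cl A →
                         ∃[ F ] (All (_∈ A) F × x ∈ cl (_∈ₗ F))) where

      -- If `x` lies in the closure of a union, finitarity yields a finite `F` inside the union; one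
      -- index chosen per element of `F` gives the finite subfamily.
      Cl₁-compact : ∀ x → IsCompact Cl (Cl₁ x)
      Cl₁-compact x I a s lub x≤s
        with finitary (union a) x (proj₂ lub (join a) (proj₁ (join-isLub a)) (x≤s (x∈Cl₁ x)))
      ... | F , F⊆⋃ , x∈clF =
        length F , f , join (a ∘ f) , join-isLub (a ∘ f) ,
        Cl₁-least (cl-closed _) (monotone _ _ F⊆ x∈clF)
        where
        chosen : ∀ k → ∃[ j ] lookup F k ∈ proj₁ (a j)
        chosen k = unresize (All.lookup F⊆⋃ (∈-lookup k))
        f : Fin (length F) → I
        f = proj₁ ∘ chosen
        F⊆ : (_∈ₗ F) ⊆ union (a ∘ f)
        F⊆ z∈F = resize (index z∈F ,
          subst (_∈ proj₁ (a (f (index z∈F))))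
            (sym (lookup-index z∈F)) (proj₂ (chosen (index z∈F))))

      isAlgebraicLattice : IsAlgebraicLattice Cl
      isAlgebraicLattice = record
        { isCompleteLattice  = isCompleteLattice
        ; compactlyGenerated = λ (A , A-closed) →
            _ , principals A , (λ { (lift (x , _)) → Cl₁-compact x }) ,
            (λ j → proj₁ A-closed ∘ proj₁ (principals-isLub A) j) ,
            (λ B bound → proj₂ (principals-isLub A) B bound ∘ extensive A)
        }

      isAlgebraic : IsAlgebraic φ
      isAlgebraic = record
        { isAlgebraicLattice = isAlgebraicLattice ; finitary = finitary }

  -- The complete chain of initial segments of a linear order.

  module InitialSegments {ℓ} {X : Set ℓ} {_≤_ : Rel X ℓ}
                         (isTotalOrder : IsTotalOrder _≡_ _≤_) where
    open IsTotalOrder isTotalOrder using (total; trans)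

    InitialSegment : Set (lsuc ℓ)
    InitialSegment = ∃ (IsInitialSegment _≤_)

    initialSegments : TotalOrder (lsuc ℓ) ℓ ℓ
    initialSegments = record
      { Carrier      = InitialSegment
      ; isTotalOrder = record
        { isPartialOrder = Poset.isPartialOrder (On.poset (⊆-poset X ℓ) proj₁)
        ; total          = ⊆-total
        }
      }
      where
      ⊆-total : (A B : InitialSegment) → (proj₁ A ⊆ proj₁ B) ⊎ (proj₁ B ⊆ proj₁ A)
      ⊆-total (A , A-init) (B , B-init) with em {P = ∃[ x ] (x ∈ A × x ∉ B)}
      ... | no ∄x = inj₁ λ {x} x∈A → byContradiction λ x∉B → ∄x (x , x∈A , x∉B)
      -- Every `b ∈ B` lies below `x`, since otherwise `x` would belong to `B`.
      ... | yes (x , x∈A , x∉B) = inj₂ λ {b} b∈B →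
        [ (λ x≤b → contradiction (B-init x b x≤b b∈B) x∉B)
        , (λ b≤x → A-init b x b≤x x∈A) ]′ (total x b)

    initialSegments-complete : IsCompleteLattice (TotalOrder.poset initialSegments)
    initialSegments-complete I a =
      ( ( (λ x → Resize ℓ (∃[ j ] x ∈ proj₁ (a j)))
        , (λ x y x≤y y∈⋃ → let j , y∈aⱼ = unresize y∈⋃ in resize (j , proj₂ (a j) x y x≤y y∈aⱼ)))
      , (λ j x∈aⱼ → resize (j , x∈aⱼ))
      , (λ B bound x∈⋃ → let j , x∈aⱼ = unresize x∈⋃ in bound j x∈aⱼ)) ,
      ( ( (λ x → Resize ℓ (∀ j → x ∈ proj₁ (a j)))
        , (λ x y x≤y y∈⋂ → resize λ j → proj₂ (a j) x y x≤y (unresize y∈⋂ j)))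
      , (λ j x∈⋂ → unresize x∈⋂ j)
      , (λ B bound x∈B → resize λ j → bound j x∈B))

    down : Pred X ℓ → InitialSegment
    down A = (λ x → ∃[ a ] (a ∈ A × x ≤ a)) ,
      λ { x y x≤y (a , a∈A , y≤a) → a , a∈A , trans x≤y y≤a }

  -- From a multichain to an algebraic convex geometry of finite dimension.

  module FromMultichain {ℓ} {X : Set ℓ} (x₀ : X) (φ : ClosureOperator X)
    (M : Multichain X) (closed≐C : ClosureOperator.Closed φ ≐ C M) where
    open ClosureOperator φ
    open ClosureProperties φ
    open Lattice φ
    open Multichain M
    module O j = IsTotalOrder (isTotalOrder j)
    module S j = InitialSegments (isTotalOrder j)

    ↓ : Fin n → Pred X ℓ → Pred X ℓ
    ↓ j A = proj₁ (S.down j A)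

    ⊆↓ : ∀ j {A} → A ⊆ ↓ j A
    ⊆↓ j {A} {x} x∈A = x , x∈A , O.refl j

    -- The closure operator whose closed sets are the members of `C M`; `cl⊆hull` and `hull⊆cl`
    -- identify it with `cl`.
    hull : Pred X ℓ → Pred X ℓ
    hull A = ⋂ (Fin n) (λ j → ↓ j A)

    cl⊆hull : ∀ {A} → cl A ⊆ hull A
    cl⊆hull {A} = cl-least hull-closed λ x∈A j → ⊆↓ j x∈A
      where
      hull-closed : Closed (hull A)
      hull-closed = proj₂ closed≐C
        ((λ j → ↓ j A) , (λ j → proj₂ (S.down j A)) , (id , id))

    -- `cl A` is an intersection of initial segments. Each of them contains `A`, hence also the
    -- down-closure of `A` in its order.
    hull⊆cl : ∀ {A} → hull A ⊆ cl A
    hull⊆cl {A} x∈hull with proj₁ closed≐C (cl-closed A)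
    ... | I , I-initial , clA≐⋂I = proj₂ clA≐⋂I λ j →
      let a , a∈A , x≤a = x∈hull j
      in I-initial j _ a x≤a (proj₁ clA≐⋂I (extensive A a∈A) j)

    someIndex : ∀ {m} → NonZero m → Fin m
    someIndex {suc m} _ = zero

    isConvexGeometry : IsConvexGeometry φ
    isConvexGeometry = record
      { nonEmpty     = x₀
      ; cl-∅         = ⊆⇒closed λ x∈cl →
          ⊥-elim (lower (proj₁ (proj₂ (cl⊆hull x∈cl (someIndex n-nonZero)))))
      ; antiExchange = antiExchange
      }
      where
      -- Some order `j` puts `x` below no element of `A`. There the witness for `x` must be `y`; the
      -- one for `y` must then be `x`, by transitivity, and antisymmetry gives `x ≡ y`.
      antiExchange : ∀ A → Closed A → ∀ x y → x ≢ y →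
                     x ∈ cl (A ∪ ｛ y ｝) → x ∉ A → y ∉ cl (A ∪ ｛ x ｝)
      antiExchange A A-closed x y x≢y x∈cl x∉A y∈cl
        with ¬∀⇒∃¬ (x∉A ∘ proj₁ A-closed ∘ hull⊆cl)
      ... | j , x∉↓A with cl⊆hull x∈cl j | cl⊆hull y∈cl j
      ... | a , inj₁ a∈A , x≤a    | _                        = x∉↓A (a , a∈A , x≤a)
      ... | _ , inj₂ refl , x≤y   | a , inj₁ a∈A , y≤a       = x∉↓A (a , a∈A , O.trans j x≤y y≤a)
      ... | _ , inj₂ refl , x≤y   | _ , inj₂ refl , y≤x      = x≢y (O.antisym j x≤y y≤x)

    -- One witness from `A` for each of the `n` orders suffices.
    finitary : ∀ A x → x ∈ cl A → ∃[ F ] (All (_∈ A) F × x ∈ cl (_∈ₗ F))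
    finitary A x x∈cl =
      tabulate a , tabulate⁺ (λ j → proj₁ (proj₂ (cl⊆hull x∈cl j))) ,
      hull⊆cl λ j → a j , ∈-tabulate⁺ j , proj₂ (proj₂ (cl⊆hull x∈cl j))
      where
      a : Fin n → X
      a j = proj₁ (cl⊆hull x∈cl j)

    ↓-mono : ∀ j {A B} → A ⊆ B → ↓ j A ⊆ ↓ j B
    ↓-mono j A⊆B (a , a∈A , x≤a) = a , A⊆B a∈A , x≤a

    ↓-cancel : ∀ {A B} → Closed B → (∀ j → ↓ j A ⊆ ↓ j B) → A ⊆ B
    ↓-cancel B-closed ↓A⊆↓B x∈A =
      proj₁ B-closed (hull⊆cl λ j → ↓A⊆↓B j (⊆↓ j x∈A))

    embedsInChains : EmbedsInChains Cl (Fin n)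
    embedsInChains =
      S.initialSegments , S.initialSegments-complete ,
      record
        { to        = λ A j → S.down j (proj₁ A)
        ; cong      = λ A≐B j → ↓-mono j (proj₁ A≐B) , ↓-mono j (proj₂ A≐B)
        ; injective = λ {A} {B} ↓A≐↓B →
            ↓-cancel (proj₂ B) (λ j → proj₁ (↓A≐↓B j)) ,
            ↓-cancel (proj₂ A) (λ j → proj₂ (↓A≐↓B j))
        } ,
      λ I a s lub →
        (λ i j → ↓-mono j (proj₁ lub i)) ,
        (λ { y bound j {x} (b , b∈s , x≤b) →
          -- The join lies in the hull of the union, so in order `j` the point `b` is below some `u`
          -- of a single member `a i`.
          let u , u∈⋃ , b≤u = cl⊆hull (proj₂ lub (join a) (proj₁ (join-isLub a)) b∈s) j
              i , u∈aᵢ      = unresize u∈⋃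
          in proj₂ (y j) x u (O.trans j x≤b b≤u) (bound i j (⊆↓ j u∈aᵢ)) })

    finiteDimension : HasFiniteDimension Cl
    finiteDimension = embedsInFin⇒finiteDimension {L = Cl} n embedsInChains

  -- From a convex geometry to a multichain: compatible preorders and their refinements.

  module ToMultichain (zorn : ∀ {c ℓ₁ ℓ₂ p} → ZornsLemma c ℓ₁ ℓ₂ p)
    {ℓ} {X : Set ℓ} (φ : ClosureOperator X)
    (convex : IsConvexGeometry φ) (algebraic : IsAlgebraic φ) where
    open ClosureOperator φ
    open ClosureProperties φ
    open Lattice φ
    open IsConvexGeometry convex
    open IsAlgebraic algebraic

    -- Closedness is asked of principal down-sets only, a condition that passes to intersections;
    -- finitarity extends it to all initial segments.
    record CompatiblePreorder : Set (lsuc ℓ) where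
      field
        _≲_         : Rel X ℓ
        trans       : Transitive _≲_
        total       : Total _≲_
        down-closed : ∀ y → Closed (λ x → x ≲ y)

      reflexive : ∀ x → x ≲ x
      reflexive x = [ id , id ]′ (total x x)

      -- Totality selects a greatest element of `a ∷ F`. The separate `a` keeps the list non-empty.
      upperBound : ∀ {I : Pred X ℓ} {a F} → a ∈ I → All (_∈ I) F →
                   ∃[ m ] (m ∈ I × a ≲ m × All (_≲ m) F)
      upperBound {a = a} a∈I []          = a , a∈I , reflexive a , []
      upperBound {a = a} {b ∷ F} a∈I (b∈I ∷ F⊆I) with total a b
      ... | inj₁ a≲b =
        let m , m∈I , b≲m , F≲m = upperBound b∈I F⊆I
        in m , m∈I , trans a≲b b≲m , b≲m ∷ F≲m
      ... | inj₂ b≲a =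
        let m , m∈I , a≲m , F≲m = upperBound a∈I F⊆I
        in m , m∈I , a≲m , trans b≲a a≲m ∷ F≲m

      -- A point of `cl I` is in the closure of a finite part of `I`. That part has an upper bound
      -- `m` in `I`, and the down-set of `m` is closed and inside `I`; an empty part is excluded by
      -- `cl-∅`.
      initialSegment-closed : ∀ {I} → IsInitialSegment _≲_ I → Closed I
      initialSegment-closed {I} I-initial = ⊆⇒closed clI⊆I
        where
        clI⊆I : cl I ⊆ I
        clI⊆I {x} x∈clI with finitary I x x∈clI
        ... | [] , _ , x∈cl∅ = ⊥-elim (lower (proj₁ cl-∅ (monotone _ _ (λ ()) x∈cl∅)))
        ... | a ∷ F , a∈I ∷ F⊆I , x∈clF =
          let m , m∈I , a≲m , F≲m = upperBound a∈I F⊆I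
          in I-initial x m (cl-least (down-closed m) (All.lookup (a≲m ∷ F≲m)) x∈clF) m∈I

    _Refines_ : Rel CompatiblePreorder ℓ
    R Refines S = ∀ x y → R._≲_ x y → S._≲_ x y
      where
      module R = CompatiblePreorder R
      module S = CompatiblePreorder S

    -- The chain condition is what gives totality. If `R` rejects `x ≲ y`, then `R` has `y ≲ x`, and
    -- so does every coarser member; a finer member also rejects `x ≲ y`, so its own totality gives
    -- `y ≲ x`.
    ⋂-compatible : ∀ {p} (𝒞 : Pred CompatiblePreorder p) →
      (∀ R S → R ∈ 𝒞 → S ∈ 𝒞 → S Refines R ⊎ R Refines S) → CompatiblePreorder
    ⋂-compatible 𝒞 chain = record
      { _≲_         = λ x y → Resize ℓ (Below x y)
      ; trans       = λ x≲y y≲z → resize λ R R∈𝒞 →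
          CompatiblePreorder.trans R (unresize x≲y R R∈𝒞) (unresize y≲z R R∈𝒞)
      ; total       = total
      ; down-closed = λ y → ⊆⇒closed λ x∈cl → resize λ R R∈𝒞 →
          cl-least (CompatiblePreorder.down-closed R y) (λ z≲y → unresize z≲y R R∈𝒞) x∈cl
      }
      where
      Below : Rel X _
      Below x y = ∀ R → R ∈ 𝒞 → CompatiblePreorder._≲_ R x y
      total : Total (λ x y → Resize ℓ (Below x y))
      total x y with em {P = ∃[ R ] (R ∈ 𝒞 × ¬ CompatiblePreorder._≲_ R x y)}
      ... | no ∄R = inj₁ (resize λ R R∈𝒞 → byContradiction λ x≴y → ∄R (R , R∈𝒞 , x≴y))
      ... | yes (R , R∈𝒞 , x≴y) = inj₂ (resize y≲x)
        where
        y≲ᴿx : CompatiblePreorder._≲_ R y x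
        y≲ᴿx = [ ⊥-elim ∘ x≴y , id ]′ (CompatiblePreorder.total R x y)
        y≲x : Below y x
        y≲x S S∈𝒞 with chain R S R∈𝒞 S∈𝒞
        ... | inj₂ R⊑S = R⊑S y x y≲ᴿx
        ... | inj₁ S⊑R = [ ⊥-elim ∘ x≴y ∘ S⊑R x y , id ]′ (CompatiblePreorder.total S x y)

    -- The order is reversed: the maximal elements are the finest preorders.

    refinements : CompatiblePreorder → Poset (lsuc ℓ) ℓ ℓ
    refinements R₀ = record
      { Carrier = ∃[ R ] R Refines R₀
      ; _≈_     = λ { (R , _) (S , _) → S Refines R × R Refines S }
      ; _≤_     = λ { (R , _) (S , _) → S Refines R }
      ; isPartialOrder = record
        { isPreorder = record
          { isEquivalence = record
            { refl  = (λ _ _ → id) , (λ _ _ → id)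
            ; sym   = swap
            ; trans = λ { (f , g) (f′ , g′) →
                (λ x y → f x y ∘ f′ x y) , (λ x y → g′ x y ∘ g x y) }
            }
          ; reflexive = proj₁
          ; trans     = λ f g x y → f x y ∘ g x y
          }
        ; antisym = _,_
        }
      }

    finest : (R₀ : CompatiblePreorder) →
      ∃[ R ] (R Refines R₀ × ∀ S → S Refines R → R Refines S)
    finest R₀ with zorn {p = lsuc ℓ} (refinements R₀) bound
      where
      bound : (𝒞 : Pred (∃[ R ] R Refines R₀) (lsuc ℓ)) →
        (∀ R S → R ∈ 𝒞 → S ∈ 𝒞 → proj₁ S Refines proj₁ R ⊎ proj₁ R Refines proj₁ S) →
        ∃[ U ] (∀ R → R ∈ 𝒞 → proj₁ U Refines proj₁ R)
      bound 𝒞 chain =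
        (⋂-compatible 𝒞₀ chain₀ , λ _ _ r → unresize r R₀ (inj₁ refl)) ,
        λ { (R , R⊑R₀) R∈𝒞 _ _ r → unresize r R (inj₂ (R⊑R₀ , R∈𝒞)) }
        where
        -- Adding `R₀` makes the intersection refine `R₀` even for the empty chain, whose own
        -- intersection would relate all points.
        𝒞₀ : Pred CompatiblePreorder (lsuc ℓ)
        𝒞₀ R = R ≡ R₀ ⊎ Σ[ R⊑R₀ ∈ R Refines R₀ ] ((R , R⊑R₀) ∈ 𝒞)
        chain₀ : ∀ R S → R ∈ 𝒞₀ → S ∈ 𝒞₀ → S Refines R ⊎ R Refines S
        chain₀ R S (inj₁ refl)         (inj₁ refl)         = inj₁ λ _ _ → id
        chain₀ R S (inj₁ refl)         (inj₂ (S⊑R₀ , _))   = inj₁ S⊑R₀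
        chain₀ R S (inj₂ (R⊑R₀ , _))   (inj₁ refl)         = inj₂ R⊑R₀
        chain₀ R S (inj₂ (R⊑R₀ , R∈𝒞)) (inj₂ (S⊑R₀ , S∈𝒞)) = chain (R , R⊑R₀) (S , S⊑R₀) R∈𝒞 S∈𝒞
    ... | (R , R⊑R₀) , maximal = R , R⊑R₀ , λ S S⊑R → maximal (S , λ x y → R⊑R₀ x y ∘ S⊑R x y) S⊑R

    -- Splitting classes, and antisymmetry of finest preorders.

    module _ (R : CompatiblePreorder) where
      open CompatiblePreorder R

      StrictlyBelow : X → Pred X ℓ
      StrictlyBelow x z = z ≲ x × ¬ x ≲ z

      strictlyBelow-closed : ∀ x → Closed (StrictlyBelow x)
      strictlyBelow-closed x = initialSegment-closed
        λ { z w z≲w (w≲x , x≴w) → trans z≲w w≲x , λ x≲z → x≴w (trans x≲z z≲w) }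

      -- The class of x is split by putting its part inside
      -- D = cl (StrictlyBelow x ∪ ｛ x ｝) below the rest.

      split : ∀ x y → y ∉ cl (StrictlyBelow x ∪ ｛ x ｝) →
        ∃[ S ] (S Refines R × ¬ CompatiblePreorder._≲_ S y x)
      split x y y∉D =
        record
          { _≲_         = λ u v → u ≲ v × (v ∈ D → u ∈ D)
          ; trans       = λ { (u≲v , f) (v≲w , g) → trans u≲v v≲w , f ∘ g }
          ; total       = total′
          ; down-closed = λ v → ⊆⇒closed λ u∈cl →
              cl-least (down-closed v) proj₁ u∈cl ,
              λ v∈D → cl-least (cl-closed _) (λ { (_ , f) → f v∈D }) u∈cl
          } ,
        (λ _ _ → proj₁) ,
        λ { (_ , f) → y∉D (f (extensive _ (inj₂ refl))) }
        where
        D : Pred X ℓ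
        D = cl (StrictlyBelow x ∪ ｛ x ｝)
        D≲x : ∀ {u} → u ∈ D → u ≲ x
        D≲x = cl-least (down-closed x) λ { (inj₁ (u≲x , _)) → u≲x ; (inj₂ refl) → reflexive x }
        D-below : ∀ {u v} → v ∈ D → u ∉ D → v ≲ u
        D-below {u} {v} v∈D u∉D with total v u
        ... | inj₁ v≲u = v≲u
        -- Here `u ≲ x`, and `u` cannot be strictly below `x` because it is outside `D`; hence
        -- `x ≲ u`.
        ... | inj₂ u≲v = trans (D≲x v∈D) (byContradiction λ x≴u →
          u∉D (extensive _ (inj₁ (trans u≲v (D≲x v∈D) , x≴u))))
        total′ : Total (λ u v → u ≲ v × (v ∈ D → u ∈ D))
        total′ u v with em {P = u ∈ D} | em {P = v ∈ D}
        ... | yes u∈D | no v∉D  = inj₁ (D-below u∈D v∉D , ⊥-elim ∘ v∉D)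
        ... | no u∉D  | yes v∈D = inj₂ (D-below v∈D u∉D , ⊥-elim ∘ u∉D)
        ... | yes u∈D | yes v∈D with total u v
        ...   | inj₁ u≲v = inj₁ (u≲v , λ _ → u∈D)
        ...   | inj₂ v≲u = inj₂ (v≲u , λ _ → v∈D)
        total′ u v | no u∉D | no v∉D with total u v
        ...   | inj₁ u≲v = inj₁ (u≲v , ⊥-elim ∘ v∉D)
        ...   | inj₂ v≲u = inj₂ (v≲u , ⊥-elim ∘ u∉D)

      -- A finest preorder admits no proper split, so of two equivalent points each lies in the
      -- closure of the other together with the points strictly below. Those strictly lower points
      -- form the same closed set for both, so anti-exchange forbids the two points to differ.
      finest-antisym : (∀ S → S Refines R → R Refines S) →
        ∀ {x y} → x ≲ y → y ≲ x → x ≡ y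
      finest-antisym R-finest {x} {y} x≲y y≲x = byContradiction λ x≢y →
        unsplittable y≲x λ y∈cl →
        unsplittable x≲y λ x∈cl →
        antiExchange (StrictlyBelow x) (strictlyBelow-closed x) y x (≢-sym x≢y)
          y∈cl (λ { (_ , x≴y) → x≴y x≲y })
          (monotone _ _
            (λ { (inj₁ (z≲y , y≴z)) → inj₁ (trans z≲y y≲x , λ x≲z → y≴z (trans y≲x x≲z))
               ; (inj₂ refl)        → inj₂ refl })
            x∈cl)
        where
        unsplittable : ∀ {u v} → v ≲ u → ¬ ¬ (v ∈ cl (StrictlyBelow u ∪ ｛ u ｝))
        unsplittable {u} {v} v≲u v∉D =
          let S , S⊑R , v≴u = split u v v∉D in v≴u (R-finest S S⊑R v u v≲u)

      finest-isTotalOrder : (∀ S → S Refines R → R Refines S) → IsTotalOrder _≡_ _≲_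
      finest-isTotalOrder R-finest = record
        { isPartialOrder = record
          { isPreorder = record
            { isEquivalence = isEquivalence
            ; reflexive     = λ { refl → reflexive _ }
            ; trans         = trans
            }
          ; antisym = finest-antisym R-finest
          }
        ; total = total
        }

    -- The multichain obtained from a join-embedding.

    module Embedding {n : ℕ} (embeds : EmbedsInChains Cl (Fin n)) where

      T : Fin n → TotalOrder (lsuc ℓ) ℓ ℓ
      T = proj₁ embeds

      module T j = TotalOrder (T j)

      open Injection (proj₁ (proj₂ (proj₂ embeds))) renaming (to to f)

      f-lub : ∀ j {I : Set (lsuc ℓ)} {a : I → Poset.Carrier Cl} {s} →
        IsLub Cl a s → IsLub (T.poset j) (λ i → f (a i) j) (f s j)
      f-lub j {I} {a} {s} lub =
        ∏-lub-pointwise T (proj₂ (proj₂ (proj₂ embeds)) I a s lub) j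

      -- When `A` is contained in `B`, the join of the two is `B`, and `f` preserves it.
      f-mono : ∀ j {A B} → proj₁ A ⊆ proj₁ B → T._≤_ j (f A j) (f B j)
      f-mono j {A} {B} A⊆B = proj₁ (f-lub j {a = pair} pair-lub) (lift true)
        where
        pair : Lift (lsuc ℓ) Bool → Poset.Carrier Cl
        pair (lift true)  = A
        pair (lift false) = B
        pair-lub : IsLub Cl pair B
        pair-lub = (λ { (lift true) → A⊆B ; (lift false) → id }) ,
                   (λ D bound → bound (lift false))

      -- The closure of this set is the join of the closures of its points, and
      -- fⱼ preserves that join.

      f≤-closed : ∀ j t → Closed (λ x → T._≤_ j (f (Cl₁ x) j) t)
      f≤-closed j t = ⊆⇒closed λ z∈clB →
        T.trans j (f-mono j {Cl₁ _} {cl B , cl-closed B} (Cl₁-least (cl-closed B) z∈clB)) clB≤t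
        where
        B : Pred X ℓ
        B x = T._≤_ j (f (Cl₁ x) j) t
        clB≤t : T._≤_ j (f (cl B , cl-closed B) j) t
        clB≤t = proj₂ (f-lub j (principals-isLub B)) t λ { (lift (x , x∈B)) → x∈B }

      ≲-compatible : Fin n → CompatiblePreorder
      ≲-compatible j = record
        { _≲_         = λ x y → T._≤_ j (f (Cl₁ x) j) (f (Cl₁ y) j)
        ; trans       = T.trans j
        ; total       = λ x y → T.total j (f (Cl₁ x) j) (f (Cl₁ y) j)
        ; down-closed = λ y → f≤-closed j (f (Cl₁ y) j)
        }

      R : Fin n → CompatiblePreorder
      R j = proj₁ (finest (≲-compatible j))

      module R j = CompatiblePreorder (R j)

      -- The hypothesis makes `f` agree on `A` and on the join of `A` with `Cl₁ x`, so injectivity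
      -- makes these closed sets equal.
      f-cancel : ∀ {A x} (A-closed : Closed A) →
        (∀ j → T._≤_ j (f (Cl₁ x) j) (f (A , A-closed) j)) → x ∈ A
      f-cancel {A} {x} A-closed fx≤fA = proj₁ A∨x≐A (proj₁ (join-isLub pair) (lift false) (x∈Cl₁ x))
        where
        pair : Lift (lsuc ℓ) Bool → Poset.Carrier Cl
        pair (lift true)  = A , A-closed
        pair (lift false) = Cl₁ x
        A∨x≐A : proj₁ (join pair) ≐ A
        A∨x≐A = injective {join pair} {A , A-closed} λ j → T.antisym j
          (proj₂ (f-lub j {a = pair} (join-isLub pair)) _
            λ { (lift true) → T.refl j ; (lift false) → fx≤fA j })
          (f-mono j {A , A-closed} {join pair} (proj₁ (join-isLub pair) (lift true)))

      n-nonZero : NonZero n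
      n-nonZero = go n refl
        where
        go : ∀ m → n ≡ m → NonZero m
        go (suc m) _    = nonZero
        -- Without chains the hypothesis of `f-cancel` is vacuous, which would put the point
        -- `nonEmpty` into `∅`.
        go zero    refl = ⊥-elim (lower (f-cancel {∅} {nonEmpty} cl-∅ λ ()))

      multichain : Multichain X
      multichain = record
        { n            = n
        ; n-nonZero    = n-nonZero
        ; _≤[_]_       = λ x j y → R._≲_ j x y
        ; isTotalOrder = λ j → finest-isTotalOrder (R j) (proj₂ (proj₂ (finest (≲-compatible j))))
        }

      closed≐C : Closed ≐ C multichain
      closed≐C = closed⊆C , C⊆closed
        where
        closed⊆C : Closed ⊆ C multichain
        closed⊆C {A} A-closed =
          -- These segments are cut out by the value of `f` at `A`; they are initial for `R j`
          -- because `R j` refines the preorder induced by `f`.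
          (λ j x → T._≤_ j (f (Cl₁ x) j) (f (A , A-closed) j)) ,
          (λ j x y x≲y y∈I → T.trans j (proj₁ (proj₂ (finest (≲-compatible j))) x y x≲y) y∈I) ,
          (λ x∈A j → f-mono j {Cl₁ _} {A , A-closed} (Cl₁-least A-closed x∈A)) ,
          f-cancel A-closed
        C⊆closed : C multichain ⊆ Closed
        C⊆closed (I , I-initial , A≐⋂I) = ⊆⇒closed λ x∈clA →
          proj₂ A≐⋂I λ j →
            cl-least (R.initialSegment-closed j (I-initial j)) (λ z∈A → proj₁ A≐⋂I z∈A j) x∈clA

theorem7p13 : (∀ {a} → ExcludedMiddle a) →
    (∀ {c ℓ₁ ℓ₂ p} → ZornsLemma c ℓ₁ ℓ₂ p) →
    ∀ {ℓ} (X : Set ℓ) → X → (φ : ClosureOperator X) →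
    (IsConvexGeometry φ × IsAlgebraic φ × HasFiniteDimension (ClosureOperator.Cl φ))
    ⇔ (∃[ M ] (ClosureOperator.Closed φ ≐ C M))
theorem7p13 em zorn X x₀ φ = mk⇔
  (λ { (convex , algebraic , n , embeds , _) →
    let open Classical.ToMultichain em zorn φ convex algebraic
        open Embedding embeds
    in multichain , closed≐C })
  (λ { (M , closed≐C) →
    let open Classical.FromMultichain em x₀ φ M closed≐C
        open Classical.Lattice em φ
    in isConvexGeometry , isAlgebraic finitary , finiteDimension })
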